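{- Let $M$ be an acyclic oriented matroid on a nonempty finite set $E$. The number of transitive $2$-colorings of $M$ is equal to $2^c$ times the number of acyclic reorientations of $M$, where $c$ is the number of connected components of $M$.
   Context: An oriented matroid is acyclic if it has no positive circuit (no signed circuit $X=(X^+,X^-)$ with $X^-=\varnothing$). A transitive $2$-coloring of $M$ is a function $\varepsilon:E\to\{1,2\}$ such that $\varepsilon(X^+)\cap\varepsilon(X^-)\ne\varnothing$ for every signed circuit $X=(X^+,X^-)$ of $M$. For $A\subseteq E$ and a signed set $X$ with support in $E$, ${}_{ -A}X$ is obtained from $X$ by reversing the signs of all elements of $A$ in the support of $X$; ${}_{ -A}M$ is the oriented matroid whose signed circuits are the ${}_{ -A}X$ for $X$ a signed circuit of $M$. A reorientation of $M$ is any oriented matroid of the form ${}_{ -A}M$, $A\subseteq E$; reorientations are counted as distinct oriented matroids on $E$ (so different $A$ giving the same oriented matroid are counted once). The connected components of $M$ are the equivalence classes of the relation on $E$: $e\sim f$ iff $e=f$ or $\{e,f\}$ is contained in (the support of) a circuit of $M$. -}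

module Defs where

open import Data.Bool using (if_then_else_)
open import Data.Fin using (Fin)
open import Data.Fin.Subset using (Subset)
import Data.Fin.Subset as Subset
open import Data.Maybe using (Maybe; just; nothing)
import Data.Maybe as Maybe
open import Data.Nat using (ℕ)
open import Data.Product using (Σ; ∃; _×_; proj₁)
open import Data.Sign using (Sign; opposite)
open import Data.Sum using (_⊎_)
open import Data.Vec using (Vec; lookup; map; replicate; zipWith)
open import Function.Bundles using (Inverse)
open import Level using (Level; 0ℓ; suc)
open import Relation.Binary.Bundles using (Setoid)
import Relation.Binary.Construct.On as On
open import Relation.Binary.PropositionalEquality using (_≡_; _≢_; setoid; _→-setoid_)
open import Relation.Nullary using (¬_)
open import Relation.Unary
  using (Pred; Decidable; Empty; Satisfiable; _∈_; _∉_; _⊆_; _≐_; _∪_; _∩_; _∖_; ｛_｝)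
open import Relation.Unary.Properties using (≐-refl; ≐-sym; ≐-trans)

private
  variable
    a b ℓ p : Level
    n : ℕ

Image : {A : Set a} {B : Set b} → (A → B) → Pred A p → Pred B _
Image f P y = ∃ λ x → x ∈ P × f x ≡ y

-- The elements of S satisfying P.  Two of them are equal when they are equal
-- in S; the proofs of P are ignored, so that each element counts once.
Restrict : (S : Setoid a ℓ) → Pred (Setoid.Carrier S) p → Setoid _ _
Restrict S P = On.setoid {B = Σ (Setoid.Carrier S) P} S proj₁

-- The number k is determined by S, since Fin k ≅ Fin l only if k ≡ l.
HasCardinality : Setoid a ℓ → ℕ → Set _
HasCardinality S k = Inverse S (setoid (Fin k))

-- A signed set with support in E = Fin n: `nothing` marks the elements outside
-- the support.  The pair (X⁺ , X⁻) of disjoint sets is (X ⁺ , X ⁻).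
SignedSubset : ℕ → Set
SignedSubset n = Vec (Maybe Sign) n

infix 20 _⁺ _⁻

_⁺ _⁻ : SignedSubset n → Pred (Fin n) 0ℓ
(X ⁺) e = lookup X e ≡ just Sign.+
(X ⁻) e = lookup X e ≡ just Sign.-

support : SignedSubset n → Pred (Fin n) 0ℓ
support X = X ⁺ ∪ X ⁻

∅ : SignedSubset n
∅ = replicate _ nothing

-_ : SignedSubset n → SignedSubset n
- X = map (Maybe.map opposite) X

reverse : Subset n → SignedSubset n → SignedSubset n
reverse = zipWith (λ inA s → if inA then Maybe.map opposite s else s)

-- The signed circuit axioms.  Decidability makes the family of circuits
-- a (detachable) subset of the finite set of all signed sets.
record OrientedMatroid (n : ℕ) : Set (suc 0ℓ) where
  field
    Circuit        : Pred (SignedSubset n) 0ℓ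
    circuit?       : Decidable Circuit
    nonempty       : ∅ ∉ Circuit
    symmetric      : ∀ {X} → X ∈ Circuit → - X ∈ Circuit
    incomparable   : ∀ {X Y} → X ∈ Circuit → Y ∈ Circuit →
                     support X ⊆ support Y → X ≡ Y ⊎ X ≡ - Y
    elimination    : ∀ {X Y} → X ∈ Circuit → Y ∈ Circuit → X ≢ - Y →
                     ∀ {e} → e ∈ X ⁺ ∩ Y ⁻ →
                     ∃ λ Z → Z ∈ Circuit
                           × Z ⁺ ⊆ (X ⁺ ∪ Y ⁺) ∖ ｛ e ｝
                           × Z ⁻ ⊆ (X ⁻ ∪ Y ⁻) ∖ ｛ e ｝

open OrientedMatroid public using (Circuit)

-- Oriented matroids are equal when they have the same signed circuits.
orientedMatroidSetoid : ℕ → Setoid (suc 0ℓ) 0ℓ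
orientedMatroidSetoid n = record
  { Carrier       = OrientedMatroid n
  ; _≈_           = λ M N → Circuit M ≐ Circuit N
  ; isEquivalence = record { refl = ≐-refl ; sym = ≐-sym ; trans = ≐-trans }
  }

Acyclic : OrientedMatroid n → Set
Acyclic M = ¬ ∃ λ X → X ∈ Circuit M × Empty (X ⁻)

IsReorientation : OrientedMatroid n → OrientedMatroid n → Set
IsReorientation M N = ∃ λ A → Circuit N ≐ Image (reverse A) (Circuit M)

AcyclicReorientations : OrientedMatroid n → Setoid _ _
AcyclicReorientations {n} M =
  Restrict (orientedMatroidSetoid n) (λ N → IsReorientation M N × Acyclic N)

Transitive : OrientedMatroid n → (Fin n → Fin 2) → Set
Transitive M ε =
  ∀ X → X ∈ Circuit M → Satisfiable (Image ε (X ⁺) ∩ Image ε (X ⁻))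

Transitive2Colorings : OrientedMatroid n → Setoid _ _
Transitive2Colorings {n} M = Restrict (Fin n →-setoid Fin 2) (Transitive M)

Connected : OrientedMatroid n → Fin n → Fin n → Set
Connected M e f =
  e ≡ f ⊎ ∃ λ X → X ∈ Circuit M × e ∈ support X × f ∈ support X

-- K is the class of some element e under Connected M.
IsComponent : OrientedMatroid n → Subset n → Set
IsComponent M K = ∃ λ e → (Subset._∈ K) ≐ Connected M e

Components : OrientedMatroid n → Setoid _ _
Components {n} M = Restrict (setoid (Subset n)) (IsComponent M)

{-# OPTIONS --safe #-}

-- Identify a coloring with a subset A of E.  Since M has no positive circuits, the coloring is
-- transitive exactly when the reorientation of M by A is acyclic.  Two subsets give the same
-- reorientation exactly when their symmetric difference C contains or misses each circuit (a circuit
-- X is then sent to ±X), that is, when C is a union of connected components.  So each reorientation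
-- arises from exactly one subset that avoids a chosen representative of every component, and an
-- arbitrary subset is such a normal one plus a choice of components, which gives the factor 2^c.
-- Connectedness is transitive by strong circuit elimination in the underlying matroid.
module Submission where

open import Data.Bool using (Bool; true; false; if_then_else_; _xor_)
import Data.Bool.Properties as Bool
open import Data.Bool.Properties using (xor-same; xor-assoc; xor-identityʳ)
open import Data.Fin using (Fin; zero; suc; _≤_; combine; funToFin; finToFun)
import Data.Fin.Properties as Fin
open import Data.Fin.Properties
  using (any?; all?; ≤-antisym; 2↔Bool; *↔×; funToFin-finToFin; finToFun-funToFin)
open import Data.Fin.Subset using (Subset; _⊂_)
  renaming (_∈_ to _∈ₛ_; _∉_ to _∉ₛ_; _⊆_ to _⊆ₛ_; _∪_ to _∪ₛ_)
open import Data.Fin.Subset.Induction using (⊂-wellFounded)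
open import Data.Fin.Subset.Properties using (_∈?_; x∈p∪q⁺; x∈p∪q⁻; ⊆-antisym)
open import Data.Maybe using (Maybe; just; nothing; is-just)
import Data.Maybe as Maybe
open import Data.Maybe.Properties using (≡-dec; just-injective)
open import Data.Nat using (ℕ; NonZero; z≤n; s≤s; _*_; _^_)
open import Data.Product using (Σ; ∃; _×_; _,_; proj₁; proj₂)
import Data.Product as Product
open import Data.Product.Function.NonDependent.Setoid using (_×-inverse_)
open import Data.Product.Relation.Binary.Pointwise.NonDependent using (_×ₛ_; ≡×≡⇒≡; ≡⇒≡×≡)
open import Data.Sign using (Sign; opposite)
import Data.Sign.Properties as Sign
open import Data.Sum using (_⊎_; inj₁; inj₂; [_,_]′)
import Data.Sum as Sum
open import Data.Vec using (Vec; []; _∷_; lookup; map; tabulate; zipWith)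
open import Data.Vec.Properties
  using (lookup-map; lookup-zipWith; lookup∘tabulate; tabulate∘lookup; tabulate-cong;
         lookup⇒[]=; []=⇒lookup)
open import Function using (_∘_; id)
open import Function.Bundles using (Inverse)
import Function.Consequences.Setoid as Consequences
import Function.Construct.Composition as Composition
import Function.Construct.Symmetry as Symmetry
open import Function.Definitions using (Congruent; StrictlyInverseˡ; StrictlyInverseʳ)
open import Induction.WellFounded using (Acc; acc)
open import Level using (Level; 0ℓ)
open import Relation.Binary.Bundles using (Setoid)
import Relation.Binary.Definitions as Binary
open import Relation.Binary.PropositionalEquality
  using (_≡_; _≢_; refl; sym; trans; cong; cong₂; subst; setoid; _→-setoid_; module ≡-Reasoning)
open import Relation.Binary.Structures using (IsEquivalence)
open import Relation.Nullary using (Dec; yes; no; ¬_; does; contradiction; ¬?; _×-dec_; _⊎-dec_)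
open import Relation.Nullary.Decidable using (map′; decidable-stable)
open import Relation.Unary
  using (Pred; Decidable; Satisfiable; _∈_; _⊆_; _≐_; _∪_; _∩_; _∖_; ｛_｝)

open import Defs

private
  variable
    a ℓ p q : Level
    m n : ℕ
    S T : Setoid a ℓ

-- Finite setoids

mkInverse : (to : Setoid.Carrier S → Setoid.Carrier T) (from : Setoid.Carrier T → Setoid.Carrier S) →
            Congruent (Setoid._≈_ S) (Setoid._≈_ T) to →
            Congruent (Setoid._≈_ T) (Setoid._≈_ S) from →
            StrictlyInverseˡ (Setoid._≈_ T) to from →
            StrictlyInverseʳ (Setoid._≈_ S) to from →
            Inverse S T
mkInverse {S = S} {T = T} to from to-cong from-cong invˡ invʳ = record
  { to        = to
  ; from      = from
  ; to-cong   = to-cong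
  ; from-cong = from-cong
  ; inverse   = Consequences.strictlyInverseˡ⇒inverseˡ S T to-cong invˡ
              , Consequences.strictlyInverseʳ⇒inverseʳ S T from-cong invʳ
  }

restrictInverse : {P : Pred (Setoid.Carrier S) p} {Q : Pred (Setoid.Carrier T) q}
                  (I : Inverse S T) →
                  (∀ {x} → P x → Q (Inverse.to I x)) →
                  (∀ {y} → Q y → P (Inverse.from I y)) →
                  Inverse (Restrict S P) (Restrict T Q)
restrictInverse I P⇒Q Q⇒P = record
  { to        = Product.map to P⇒Q
  ; from      = Product.map from Q⇒P
  ; to-cong   = to-cong
  ; from-cong = from-cong
  ; inverse   = inverseˡ , inverseʳ
  }
  where open Inverse I

restrictFin : {P : Pred (Fin m) p} → Decidable P →
              ∃ (HasCardinality (Restrict (setoid (Fin m)) P))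
restrictFin {m = ℕ.zero} P? = 0 , mkInverse (λ ()) (λ ()) (λ { {()} }) (λ { {()} }) (λ ()) (λ { (() , _) })
restrictFin {m = ℕ.suc m} {P = P} P? with P? zero | restrictFin (P? ∘ suc)
... | yes p | k , I = ℕ.suc k , mkInverse to from to-cong (cong from′) invˡ invʳ
  where
  to : Σ (Fin (ℕ.suc m)) P → Fin (ℕ.suc k)
  to (zero  , _) = zero
  to (suc i , q) = suc (Inverse.to I (i , q))

  from : Fin (ℕ.suc k) → Σ (Fin (ℕ.suc m)) P
  from zero    = zero , p
  from (suc j) = Product.map suc id (Inverse.from I j)

  from′ : Fin (ℕ.suc k) → Fin (ℕ.suc m)
  from′ = proj₁ ∘ from

  to-cong : ∀ {x y} → proj₁ x ≡ proj₁ y → to x ≡ to y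
  to-cong {zero  , _} {zero  , _} _    = refl
  to-cong {suc i , _} {suc i , _} refl = cong suc (Inverse.to-cong I refl)

  invˡ : ∀ j → to (from j) ≡ j
  invˡ zero    = refl
  invˡ (suc j) = cong suc (Inverse.strictlyInverseˡ I j)

  invʳ : ∀ x → proj₁ (from (to x)) ≡ proj₁ x
  invʳ (zero  , _) = refl
  invʳ (suc i , q) = cong suc (Inverse.strictlyInverseʳ I (i , q))
... | no ¬p | k , I = k , mkInverse to from to-cong (cong (proj₁ ∘ from)) invˡ invʳ
  where
  to : Σ (Fin (ℕ.suc m)) P → Fin k
  to (zero  , p) = contradiction p ¬p
  to (suc i , q) = Inverse.to I (i , q)

  from : Fin k → Σ (Fin (ℕ.suc m)) P
  from j = Product.map suc id (Inverse.from I j)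

  to-cong : ∀ {x y} → proj₁ x ≡ proj₁ y → to x ≡ to y
  to-cong {zero  , p} _ = contradiction p ¬p
  to-cong {suc i , _} {suc i , _} refl = Inverse.to-cong I refl

  invˡ : ∀ j → to (from j) ≡ j
  invˡ j = Inverse.strictlyInverseˡ I j

  invʳ : ∀ x → proj₁ (from (to x)) ≡ proj₁ x
  invʳ (zero  , p) = contradiction p ¬p
  invʳ (suc i , q) = cong suc (Inverse.strictlyInverseʳ I (i , q))

-- The predicate is pulled back along the enumeration of `S` and filtered there. A round trip
-- returns only an equal element, hence the assumption that `P` respects equality.
restrictFinite : {P : Pred (Setoid.Carrier S) p} → HasCardinality S m →
                 Decidable P → P Binary.Respects Setoid._≈_ S →
                 ∃ (HasCardinality (Restrict S P))
restrictFinite {S = S} I P? resp with restrictFin (P? ∘ Inverse.from I)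
... | k , J = k , Composition.inverse
                    (restrictInverse I (resp (Setoid.sym S (Inverse.strictlyInverseʳ I _))) id) J

subset↔coloring : Inverse (setoid (Subset n)) (Fin n →-setoid Fin 2)
subset↔coloring = mkInverse
  (λ A → from ∘ lookup A)
  (λ ε → tabulate (to ∘ ε))
  (λ A≡B e → cong (λ A → from (lookup A e)) A≡B)
  (λ ε≗δ → tabulate-cong (cong to ∘ ε≗δ))
  (λ ε e → trans (cong from (lookup∘tabulate _ e)) (strictlyInverseʳ (ε e)))
  (λ A → trans (tabulate-cong (strictlyInverseˡ ∘ lookup A)) (tabulate∘lookup A))
  where open Inverse 2↔Bool

coloring-cardinality : HasCardinality (Fin n →-setoid Fin m) (m ^ n)
coloring-cardinality {n} {m} = mkInverse funToFin finToFun (funToFin-cong {n}) (λ { refl _ → refl })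
  (funToFin-finToFin {n} {m}) finToFun-funToFin
  where
  funToFin-cong : ∀ {k} {f g : Fin k → Fin m} → (∀ i → f i ≡ g i) → funToFin f ≡ funToFin g
  funToFin-cong {ℕ.zero}  f≗g = refl
  funToFin-cong {ℕ.suc k} f≗g = cong₂ combine (f≗g zero) (funToFin-cong (f≗g ∘ suc))

subset-cardinality : HasCardinality (setoid (Subset n)) (2 ^ n)
subset-cardinality = Composition.inverse subset↔coloring coloring-cardinality

product-cardinality : ∀ {k l} → HasCardinality S k → HasCardinality T l → HasCardinality (S ×ₛ T) (k * l)
product-cardinality {k = k} {l} I J = Composition.inverse (I ×-inverse J)
  (mkInverse from to (cong from ∘ ≡×≡⇒≡) (≡⇒≡×≡ ∘ cong to) strictlyInverseʳ (≡⇒≡×≡ ∘ strictlyInverseˡ))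
  where open Inverse (*↔× {k} {l})

-- Exhaustive search over signed sets

anyMaybeSign? : {P : Pred (Maybe Sign) p} → Decidable P → Dec (∃ P)
anyMaybeSign? P? = map′
  [ (nothing ,_) , [ (just Sign.+ ,_) , (just Sign.- ,_) ]′ ]′
  (λ { (nothing , x) → inj₁ x ; (just Sign.+ , x) → inj₂ (inj₁ x) ; (just Sign.- , x) → inj₂ (inj₂ x) })
  (P? nothing ⊎-dec P? (just Sign.+) ⊎-dec P? (just Sign.-))

anySignedSubset? : {P : Pred (SignedSubset n) p} → Decidable P → Dec (∃ P)
anySignedSubset? {n = ℕ.zero}  P? = map′ ([] ,_) (λ { ([] , x) → x }) (P? [])
anySignedSubset? {n = ℕ.suc n} P? = map′
  (λ { (s , X , x) → s ∷ X , x })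
  (λ { (s ∷ X , x) → s , X , x })
  (anyMaybeSign? (λ s → anySignedSubset? (P? ∘ (s ∷_))))

vec-ext : {A : Set a} {xs ys : Vec A n} → (∀ i → lookup xs i ≡ lookup ys i) → xs ≡ ys
vec-ext {xs = xs} {ys} eq =
  trans (sym (tabulate∘lookup xs)) (trans (tabulate-cong eq) (tabulate∘lookup ys))

-- Representatives of the classes of a decidable equivalence

least : {P : Pred (Fin n) p} → Decidable P → ∃ P → ∃ λ i → P i × (∀ {j} → P j → i ≤ j)
least {n = ℕ.suc n} P? (i , x) with P? zero
least {n = ℕ.suc n} P? (i     , x) | yes y = zero , y , λ _ → z≤n
least {n = ℕ.suc n} P? (zero  , x) | no ¬y = contradiction x ¬y
least {n = ℕ.suc n} P? (suc i , x) | no ¬y with least (P? ∘ suc) (i , x)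
... | k , z , min = suc k , z , λ { {zero} w → contradiction w ¬y ; {suc j} w → s≤s (min w) }

module Representatives {_~_ : Fin n → Fin n → Set ℓ} (_~?_ : Binary.Decidable _~_)
                       (equivalence : IsEquivalence _~_) where
  private module ~ = IsEquivalence equivalence

  -- The least element of the class: a canonical choice that depends on the class alone.
  rep : Fin n → Fin n
  rep e = proj₁ (least (e ~?_) (e , ~.refl))

  rep-~ : ∀ e → e ~ rep e
  rep-~ e = proj₁ (proj₂ (least (e ~?_) (e , ~.refl)))

  -- Each of the two minima also lies in the class of the other element, so each is at most the
  -- other.
  rep-cong : ∀ {e f} → e ~ f → rep e ≡ rep f
  rep-cong {e} {f} e~f = ≤-antisym
    (proj₂ (proj₂ (least (e ~?_) (e , ~.refl))) (~.trans e~f (rep-~ f)))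
    (proj₂ (proj₂ (least (f ~?_) (f , ~.refl))) (~.trans (~.sym e~f) (rep-~ e)))

  rep-idem : ∀ e → rep (rep e) ≡ rep e
  rep-idem e = sym (rep-cong (rep-~ e))

  IsRep : Pred (Fin n) 0ℓ
  IsRep e = rep e ≡ e

  isRep? : Decidable IsRep
  isRep? e = rep e Fin.≟ e

  -- For `Connected M` this unfolds to `Components M`.
  Classes : Setoid _ _
  Classes = Restrict (setoid (Subset n)) (λ K → ∃ λ e → (_∈ₛ K) ≐ (e ~_))

  class : Fin n → Subset n
  class e = tabulate (does ∘ (e ~?_))

  ∈class⁺ : ∀ {e f} → e ~ f → f ∈ₛ class e
  ∈class⁺ {e} {f} e~f with e ~? f in eq
  ... | yes _   = lookup⇒[]= f _ (trans (lookup∘tabulate _ f) (cong does eq))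
  ... | no  e≁f = contradiction e~f e≁f

  ∈class⁻ : ∀ {e f} → f ∈ₛ class e → e ~ f
  ∈class⁻ {e} {f} f∈ with e ~? f in eq
  ... | yes e~f = e~f
  ... | no  _   with trans (sym ([]=⇒lookup f∈)) (trans (lookup∘tabulate _ f) (cong does eq))
  ...   | ()

  classes↔reps : Inverse Classes (Restrict (setoid (Fin n)) IsRep)
  classes↔reps = mkInverse
    (λ { (K , e , _) → rep e , rep-idem e })
    (λ { (e , _) → class e , e , ∈class⁻ , ∈class⁺ })
    (λ { {K , e , _ , ⊇} {.K , f , ⊆ , _} refl → sym (rep-cong (⊆ (⊇ ~.refl))) })
    (λ { refl → refl })
    proj₂
    (λ { (K , e , ⊆ , ⊇) → ⊆-antisym
           (λ x → ⊇ (~.trans (rep-~ e) (∈class⁻ x)))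
           (λ x → ∈class⁺ (~.trans (~.sym (rep-~ e)) (⊆ x))) })

-- Connectivity of a matroid

⊈⇒∃∉ : {C D : Subset n} → ¬ (C ⊆ₛ D) → ∃ λ e → e ∈ₛ C × e ∉ₛ D
⊈⇒∃∉ {C = C} {D} C⊈D with any? (λ e → e ∈? C ×-dec ¬? (e ∈? D))
... | yes found = found
... | no ¬found = contradiction
  (λ {e} e∈C → decidable-stable (e ∈? D) (λ e∉D → ¬found (e , e∈C , e∉D))) C⊈D

module MatroidCircuits {𝒞 : Pred (Subset n) ℓ}
  (incomparable : ∀ {C D} → C ∈ 𝒞 → D ∈ 𝒞 → C ⊆ₛ D → D ⊆ₛ C)
  (elimination : ∀ {C D e} → C ∈ 𝒞 → D ∈ 𝒞 → C ≢ D → e ∈ₛ C → e ∈ₛ D →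
                 ∃ λ Z → Z ∈ 𝒞 × e ∉ₛ Z × Z ⊆ₛ C ∪ₛ D)
  where

  private
    variable
      C D Z : Subset n
      e f g : Fin n

    ∪-least : ∀ (C D : Subset n) → C ⊆ₛ Z → D ⊆ₛ Z → C ∪ₛ D ⊆ₛ Z
    ∪-least C D C⊆ D⊆ = [ C⊆ , D⊆ ]′ ∘ x∈p∪q⁻ C D

    ∪-left : C ⊆ₛ C ∪ₛ D
    ∪-left = x∈p∪q⁺ ∘ inj₁

    ∪-right : D ⊆ₛ C ∪ₛ D
    ∪-right {D} {C} = x∈p∪q⁺ {p = C} ∘ inj₂

    ∉-∪ : e ∉ₛ C → e ∉ₛ D → e ∉ₛ C ∪ₛ D
    ∉-∪ {C = C} {D} e∉C e∉D = [ e∉C , e∉D ]′ ∘ x∈p∪q⁻ C D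

    -- If `Z` lay inside `C`, incomparability would give `C ⊆ₛ Z`, against `g`. An element of `Z`
    -- outside `C` must come from `D`.
    new-element : C ∈ 𝒞 → Z ∈ 𝒞 → Z ⊆ₛ C ∪ₛ D → g ∈ₛ C → g ∉ₛ Z →
                  ∃ λ h → h ∈ₛ Z × h ∉ₛ C × h ∈ₛ D
    new-element {C} {Z} {D} C∈ Z∈ Z⊆ g∈C g∉Z
      with h , h∈Z , h∉C ← ⊈⇒∃∉ (λ Z⊆C → g∉Z (incomparable Z∈ C∈ Z⊆C g∈C))
      = h , h∈Z , h∉C , [ (λ h∈C → contradiction h∈C h∉C) , id ]′ (x∈p∪q⁻ C D (Z⊆ h∈Z))

  -- Induction on the union of the two circuits: weak elimination gives a circuit avoiding `g`, and
  -- if it loses `e`, two eliminations inside smaller unions recover `e`.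
  strong-elimination′ : Acc _⊂_ (C ∪ₛ D) → C ∈ 𝒞 → D ∈ 𝒞 → g ∈ₛ C → g ∈ₛ D → e ∈ₛ C → e ∉ₛ D →
                        ∃ λ Z → Z ∈ 𝒞 × e ∈ₛ Z × g ∉ₛ Z × Z ⊆ₛ C ∪ₛ D
  strong-elimination′ {C} {D} {g} {e} (acc rs) C∈ D∈ g∈C g∈D e∈C e∉D
    with Z , Z∈ , g∉Z , Z⊆ ← elimination C∈ D∈ (λ { refl → e∉D e∈C }) g∈C g∈D
    with e ∈? Z
  ... | yes e∈Z = Z , Z∈ , e∈Z , g∉Z , Z⊆
  ... | no  e∉Z
    with h , h∈Z , h∉C , h∈D ← new-element C∈ Z∈ Z⊆ g∈C g∉Z
    -- Eliminate `h` from `D` and `Z` while keeping `g`; the union has shrunk because `e` is in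
    -- neither.
    with Y , Y∈ , g∈Y , h∉Y , Y⊆ ← strong-elimination′
           (rs (∪-least D Z (∪-right {C = C}) Z⊆ , e , ∪-left e∈C , ∉-∪ e∉D e∉Z))
           D∈ Z∈ h∈D h∈Z g∈D g∉Z
    with Y⊆C∪D ← (λ {x} (x∈Y : x ∈ₛ Y) → ∪-least D Z (∪-right {C = C}) Z⊆ (Y⊆ x∈Y))
    -- `Y` contains `g` but not `e`, so it can replace `D`; now `h` is missing from the union.
    with W , W∈ , e∈W , g∉W , W⊆ ← strong-elimination′
           (rs (∪-least C Y ∪-left Y⊆C∪D , h , ∪-right {C = C} h∈D , ∉-∪ h∉C h∉Y))
           C∈ Y∈ g∈C g∈Y e∈C (λ e∈Y → ∉-∪ e∉D e∉Z (Y⊆ e∈Y))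
    = W , W∈ , e∈W , g∉W , λ x → ∪-least C Y ∪-left Y⊆C∪D (W⊆ x)

  strong-elimination : C ∈ 𝒞 → D ∈ 𝒞 → g ∈ₛ C → g ∈ₛ D → e ∈ₛ C → e ∉ₛ D →
                       ∃ λ Z → Z ∈ 𝒞 × e ∈ₛ Z × g ∉ₛ Z × Z ⊆ₛ C ∪ₛ D
  strong-elimination = strong-elimination′ (⊂-wellFounded _)

  -- Eliminating g from C and D while keeping e, resp. f, gives circuits V and W.
  -- One of the pairs (V , W), (V , D) meets and has a smaller union.
  common-circuit′ : Acc _⊂_ (C ∪ₛ D) → C ∈ 𝒞 → D ∈ 𝒞 → g ∈ₛ C → g ∈ₛ D → e ∈ₛ C → f ∈ₛ D →
                    ∃ λ Z → Z ∈ 𝒞 × e ∈ₛ Z × f ∈ₛ Z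
  common-circuit′ {C} {D} {g} {e} {f} (acc rs) C∈ D∈ g∈C g∈D e∈C f∈D
    with e ∈? D | f ∈? C
  ... | yes e∈D | _       = D , D∈ , e∈D , f∈D
  ... | no  _   | yes f∈C = C , C∈ , e∈C , f∈C
  ... | no  e∉D | no  f∉C
    with V , V∈ , e∈V , g∉V , V⊆ ← strong-elimination C∈ D∈ g∈C g∈D e∈C e∉D
    with W , W∈ , f∈W , g∉W , W⊆′ ← strong-elimination D∈ C∈ g∈D g∈C f∈D f∉C
    with W⊆ ← (λ {x} (x∈W : x ∈ₛ W) → ∪-least D C (∪-right {C = C}) ∪-left (W⊆′ x∈W))
    with h , h∈V , _ , h∈D ← new-element C∈ V∈ V⊆ g∈C g∉V
    -- If `k` is in `V`, then `V` and `W` meet in `k` and their union misses `g`. Otherwise `V` and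
    -- `D` meet in `h` and their union misses `k`.
    with k , k∈W , k∉D , k∈C ← new-element D∈ W∈ W⊆′ g∈D g∉W
    with k ∈? V
  ... | yes k∈V = common-circuit′
    (rs (∪-least V W V⊆ W⊆ , g , ∪-left g∈C , ∉-∪ g∉V g∉W))
    V∈ W∈ k∈V k∈W e∈V f∈W
  ... | no  k∉V = common-circuit′
    (rs (∪-least V D V⊆ (∪-right {C = C}) , k , ∪-left k∈C , ∉-∪ k∉V k∉D))
    V∈ D∈ h∈V h∈D e∈V f∈D

  common-circuit : C ∈ 𝒞 → D ∈ 𝒞 → g ∈ₛ C → g ∈ₛ D → e ∈ₛ C → f ∈ₛ D →
                   ∃ λ Z → Z ∈ 𝒞 × e ∈ₛ Z × f ∈ₛ Z
  common-circuit = common-circuit′ (⊂-wellFounded _)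
-- Signed sets

flipBy : Bool → Sign → Sign
flipBy b s = if b then opposite s else s

flipBy-involutive : ∀ b s → flipBy b (flipBy b s) ≡ s
flipBy-involutive true  s = Sign.opposite-involutive s
flipBy-involutive false s = refl

flipBy-injective : ∀ b c s → flipBy b s ≡ flipBy c s → b ≡ c
flipBy-injective true  true  _      _ = refl
flipBy-injective false false _      _ = refl
flipBy-injective true  false Sign.+ ()
flipBy-injective true  false Sign.- ()
flipBy-injective false true  Sign.+ ()
flipBy-injective false true  Sign.- ()

-- Unfolds to `X ⁺` or `X ⁻`; with the sign as a parameter, one argument serves both halves.
part : Sign → SignedSubset n → Pred (Fin n) 0ℓ
part s X e = lookup X e ≡ just s

part? : ∀ s (X : SignedSubset n) → Decidable (part s X)
part? s X e = ≡-dec Sign._≟_ (lookup X e) (just s)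

support? : (X : SignedSubset n) → Decidable (support X)
support? X e = part? Sign.+ X e ⊎-dec part? Sign.- X e

∈support : ∀ (X : SignedSubset n) s {e} → e ∈ part s X → e ∈ support X
∈support X Sign.+ = inj₁
∈support X Sign.- = inj₂

∈support⁻ : ∀ (X : SignedSubset n) {e} → e ∈ support X → ∃ λ s → e ∈ part s X
∈support⁻ X = [ (Sign.+ ,_) , (Sign.- ,_) ]′

-- The support as a `Subset`, the form in which the matroid lemmas take unions and recurse on strict
-- inclusion.
supp : SignedSubset n → Subset n
supp = map is-just

∈supp⁺ : ∀ (X : SignedSubset n) {e} → e ∈ support X → e ∈ₛ supp X
∈supp⁺ X {e} e∈X with s , eq ← ∈support⁻ X e∈X =
  lookup⇒[]= e (supp X) (trans (lookup-map e is-just X) (cong is-just eq))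

∈supp⁻ : ∀ (X : SignedSubset n) {e} → e ∈ₛ supp X → e ∈ support X
∈supp⁻ X {e} e∈X with lookup X e | trans (sym ([]=⇒lookup e∈X)) (lookup-map e is-just X)
... | just Sign.+ | _ = inj₁ refl
... | just Sign.- | _ = inj₂ refl

-- Symmetric difference; by `reverse-reverse` it is how successive reversals compose.
_⊕_ : Subset n → Subset n → Subset n
_⊕_ = zipWith _xor_

lookup-reverse : ∀ (A : Subset n) X {e s} → e ∈ part s X →
                 e ∈ part (flipBy (lookup A e) s) (reverse A X)
lookup-reverse A X {e} eq
  with lookup A e | lookup X e | lookup-zipWith (λ inA s → if inA then Maybe.map opposite s else s) e A X
lookup-reverse A X refl | true  | _ | eq = eq
lookup-reverse A X refl | false | _ | eq = eq

reverse-∅ : ∀ (A : Subset n) → reverse A ∅ ≡ ∅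
reverse-∅ []          = refl
reverse-∅ (true  ∷ A) = cong (nothing ∷_) (reverse-∅ A)
reverse-∅ (false ∷ A) = cong (nothing ∷_) (reverse-∅ A)

opposite-involutive : ∀ s → Maybe.map opposite (Maybe.map opposite s) ≡ s
opposite-involutive nothing  = refl
opposite-involutive (just s) = cong just (Sign.opposite-involutive s)

reverse-reverse : ∀ (A B : Subset n) X → reverse A (reverse B X) ≡ reverse (A ⊕ B) X
reverse-reverse []          []          []      = refl
reverse-reverse (true  ∷ A) (true  ∷ B) (s ∷ X) = cong₂ _∷_ (opposite-involutive s) (reverse-reverse A B X)
reverse-reverse (true  ∷ A) (false ∷ B) (s ∷ X) = cong (_ ∷_) (reverse-reverse A B X)
reverse-reverse (false ∷ A) (true  ∷ B) (s ∷ X) = cong (_ ∷_) (reverse-reverse A B X)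
reverse-reverse (false ∷ A) (false ∷ B) (s ∷ X) = cong (_ ∷_) (reverse-reverse A B X)

reverse-involutive : ∀ (A : Subset n) X → reverse A (reverse A X) ≡ X
reverse-involutive []          []      = refl
reverse-involutive (true  ∷ A) (s ∷ X) = cong₂ _∷_ (opposite-involutive s) (reverse-involutive A X)
reverse-involutive (false ∷ A) (s ∷ X) = cong (s ∷_) (reverse-involutive A X)

lookup-unreverse : ∀ (A : Subset n) X {e s} → e ∈ part s (reverse A X) →
                   e ∈ part (flipBy (lookup A e) s) X
lookup-unreverse A X {e} {s} x = subst (λ Y → e ∈ part (flipBy (lookup A e) s) Y)
  (reverse-involutive A X) (lookup-reverse A (reverse A X) x)

reverse-neg : ∀ (A : Subset n) X → reverse A (- X) ≡ - reverse A X
reverse-neg []          []      = refl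
reverse-neg (true  ∷ A) (s ∷ X) = cong (_ ∷_) (reverse-neg A X)
reverse-neg (false ∷ A) (s ∷ X) = cong (_ ∷_) (reverse-neg A X)

is-just-opposite : ∀ s → is-just (Maybe.map opposite s) ≡ is-just s
is-just-opposite nothing  = refl
is-just-opposite (just s) = refl

supp-reverse : ∀ (A : Subset n) X → supp (reverse A X) ≡ supp X
supp-reverse []          []      = refl
supp-reverse (true  ∷ A) (s ∷ X) = cong₂ _∷_ (is-just-opposite s) (supp-reverse A X)
supp-reverse (false ∷ A) (s ∷ X) = cong (_ ∷_) (supp-reverse A X)

neg-involutive : ∀ (X : SignedSubset n) → - - X ≡ X
neg-involutive []      = refl
neg-involutive (s ∷ X) = cong₂ _∷_ (opposite-involutive s) (neg-involutive X)

supp-neg : ∀ (X : SignedSubset n) → supp (- X) ≡ supp X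
supp-neg []      = refl
supp-neg (s ∷ X) = cong₂ _∷_ (is-just-opposite s) (supp-neg X)

part-neg : ∀ (X : SignedSubset n) {s e} → e ∈ part s X → e ∈ part (opposite s) (- X)
part-neg X {e = e} eq = trans (lookup-map e _ X) (cong (Maybe.map opposite) eq)

support-reverse : ∀ (A : Subset n) X → support (reverse A X) ≐ support X
support-reverse A X =
  (λ x → ∈supp⁻ X (subst (_ ∈ₛ_) (supp-reverse A X) (∈supp⁺ (reverse A X) x))) ,
  (λ x → ∈supp⁻ (reverse A X) (subst (_ ∈ₛ_) (sym (supp-reverse A X)) (∈supp⁺ X x)))

-- Entries of `C` outside the support of `X` act on `nothing` and have no effect.
reverse-constant : ∀ {C : Subset n} {X} b → (∀ {e} → e ∈ support X → lookup C e ≡ b) →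
                   reverse C X ≡ (if b then - X else X)
reverse-constant {C = []} {[]} true  _ = refl
reverse-constant {C = []} {[]} false _ = refl
reverse-constant {C = c ∷ C} {s ∷ X} b const = trans
  (cong₂ _∷_ (head c s b (λ {t} eq → const {zero} (∈support (s ∷ X) t {zero} eq))) (reverse-constant b (λ {e} → const {suc e})))
  (if-∷ b)
  where
  if-∷ : ∀ b → (if b then Maybe.map opposite s else s) ∷ (if b then - X else X) ≡ (if b then - (s ∷ X) else s ∷ X)
  if-∷ true  = refl
  if-∷ false = refl

  head : ∀ c s b → (∀ {t} → s ≡ just t → c ≡ b) →
         (if c then Maybe.map opposite s else s) ≡ (if b then Maybe.map opposite s else s)
  head true  nothing  true  _ = refl
  head true  nothing  false _ = refl
  head false nothing  true  _ = refl
  head false nothing  false _ = refl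
  head c     (just s) b     h = cong (λ c → if c then Maybe.map opposite (just s) else just s) (h refl)

-- Reorientations

module Reorientation (M : OrientedMatroid n) where
  open OrientedMatroid M hiding (Circuit)

  -- Reversal can exchange the signs at `e`, so elimination is needed for either sign there. The
  -- case of `Sign.-` exchanges `X` and `Y`.
  eliminate : ∀ s {X Y e} → X ∈ Circuit M → Y ∈ Circuit M → X ≢ - Y →
              e ∈ part s X → e ∈ part (opposite s) Y →
              ∃ λ Z → Z ∈ Circuit M × (∀ t → part t Z ⊆ (part t X ∪ part t Y) ∖ ｛ e ｝)
  eliminate Sign.+ X∈ Y∈ X≢-Y e∈X e∈Y with Z , Z∈ , Z⁺ , Z⁻ ← elimination X∈ Y∈ X≢-Y (e∈X , e∈Y) =
    Z , Z∈ , λ { Sign.+ → Z⁺ ; Sign.- → Z⁻ }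
  eliminate Sign.- {X} {Y} X∈ Y∈ X≢-Y e∈X e∈Y
    with Z , Z∈ , Z⁺ , Z⁻ ← elimination Y∈ X∈
           (λ Y≡-X → X≢-Y (trans (sym (neg-involutive X)) (cong -_ (sym Y≡-X)))) (e∈Y , e∈X) =
    Z , Z∈ , λ { Sign.+ → Product.map₁ Sum.swap ∘ Z⁺ ; Sign.- → Product.map₁ Sum.swap ∘ Z⁻ }

  -- The circuits form a preimage rather than an image, so decidability is inherited at once; the
  -- two agree because `reverse A` is an involution.
  reorient : Subset n → OrientedMatroid n
  reorient A = record
    { Circuit      = λ X → reverse A X ∈ Circuit M
    ; circuit?     = λ X → circuit? (reverse A X)
    ; nonempty     = nonempty ∘ subst (Circuit M) (reverse-∅ A)
    ; symmetric    = λ {X} X∈ → subst (Circuit M) (sym (reverse-neg A X)) (symmetric X∈)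
    ; incomparable = λ {X} {Y} X∈ Y∈ X⊆Y → Sum.map
        (λ eq → trans (sym (reverse-involutive A X)) (trans (cong (reverse A) eq) (reverse-involutive A Y)))
        (λ eq → trans (sym (reverse-involutive A X)) (trans (cong (reverse A) eq)
                  (trans (reverse-neg A (reverse A Y)) (cong -_ (reverse-involutive A Y)))))
        (incomparable X∈ Y∈ (λ x → proj₂ (support-reverse A Y) (X⊆Y (proj₁ (support-reverse A X) x))))
    ; elimination  = elim
    }
    where
    unreverse : ∀ {X e} s → e ∈ part (flipBy (lookup A e) s) (reverse A X) → e ∈ part s X
    unreverse {X} {e} s x = subst (λ t → e ∈ part t X)
      (flipBy-involutive (lookup A e) s) (lookup-unreverse A X x)

    flip-opposite : ∀ b → flipBy b Sign.- ≡ opposite (flipBy b Sign.+)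
    flip-opposite true  = refl
    flip-opposite false = refl

    elim : ∀ {X Y} → reverse A X ∈ Circuit M → reverse A Y ∈ Circuit M → X ≢ - Y →
           ∀ {e} → e ∈ X ⁺ ∩ Y ⁻ →
           ∃ λ Z → reverse A Z ∈ Circuit M
                 × Z ⁺ ⊆ (X ⁺ ∪ Y ⁺) ∖ ｛ e ｝
                 × Z ⁻ ⊆ (X ⁻ ∪ Y ⁻) ∖ ｛ e ｝
    elim {X} {Y} X∈ Y∈ X≢-Y {e} (e∈X , e∈Y)
      -- Elimination runs in `M`, at the sign that `X` acquires at `e` under reversal; the circuit
      -- found is reversed back.
      with Z , Z∈ , Z⊆ ← eliminate (flipBy (lookup A e) Sign.+) X∈ Y∈
             (λ eq → X≢-Y (trans (sym (reverse-involutive A X)) (trans (cong (reverse A) eq)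
                       (trans (reverse-neg A (reverse A Y)) (cong -_ (reverse-involutive A Y))))))
             (lookup-reverse A X e∈X)
             (subst (λ s → e ∈ part s (reverse A Y)) (flip-opposite (lookup A e)) (lookup-reverse A Y e∈Y))
      = reverse A Z , subst (Circuit M) (sym (reverse-involutive A Z)) Z∈ , sub Sign.+ , sub Sign.-
      where
      sub : ∀ s → part s (reverse A Z) ⊆ (part s X ∪ part s Y) ∖ ｛ e ｝
      sub s {f} x = Product.map₁ (Sum.map (unreverse s) (unreverse s))
        (Z⊆ (flipBy (lookup A f) s) (lookup-unreverse A Z x))

  reorient-image : ∀ A → Circuit (reorient A) ≐ Image (reverse A) (Circuit M)
  reorient-image A =
    (λ {X} X∈ → reverse A X , X∈ , reverse-involutive A X) ,
    (λ { (Y , Y∈ , refl) → subst (Circuit M) (sym (reverse-involutive A Y)) Y∈ })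

  -- The underlying matroid and its components

  same-support : ∀ {X Y} → X ∈ Circuit M → Y ∈ Circuit M → supp X ⊆ₛ supp Y → X ≡ Y ⊎ X ≡ - Y
  same-support {X} {Y} X∈ Y∈ X⊆Y = incomparable X∈ Y∈ (λ x → ∈supp⁻ Y (X⊆Y (∈supp⁺ X x)))

  supports : Pred (Subset n) 0ℓ
  supports = Image supp (Circuit M)

  supports-incomparable : ∀ {C D} → C ∈ supports → D ∈ supports → C ⊆ₛ D → D ⊆ₛ C
  supports-incomparable (X , X∈ , refl) (Y , Y∈ , refl) C⊆D with same-support X∈ Y∈ C⊆D
  ... | inj₁ refl = id
  ... | inj₂ refl = subst (_ ∈ₛ_) (sym (supp-neg Y))

  circuit-through : ∀ {X e} → X ∈ Circuit M → e ∈ support X → ∀ s →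
                    ∃ λ Y → Y ∈ Circuit M × supp Y ≡ supp X × e ∈ part s Y
  circuit-through {X} X∈ (inj₁ e∈X) Sign.+ = X , X∈ , refl , e∈X
  circuit-through {X} X∈ (inj₁ e∈X) Sign.- = - X , symmetric X∈ , supp-neg X , part-neg X e∈X
  circuit-through {X} X∈ (inj₂ e∈X) Sign.+ = - X , symmetric X∈ , supp-neg X , part-neg X e∈X
  circuit-through {X} X∈ (inj₂ e∈X) Sign.- = X , X∈ , refl , e∈X

  -- Replacing circuits by their negatives keeps the supports and makes the signs at `e` opposite,
  -- so that signed elimination applies. Distinct supports rule out `X′ ≡ - Y′`.
  supports-elimination : ∀ {C D e} → C ∈ supports → D ∈ supports → C ≢ D → e ∈ₛ C → e ∈ₛ D →
                         ∃ λ Z → Z ∈ supports × e ∉ₛ Z × Z ⊆ₛ C ∪ₛ D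
  supports-elimination {e = e} (X , X∈ , refl) (Y , Y∈ , refl) C≢D e∈C e∈D
    with X′ , X′∈ , suppX′ , e∈X′ ← circuit-through X∈ (∈supp⁻ X e∈C) Sign.+
    with Y′ , Y′∈ , suppY′ , e∈Y′ ← circuit-through Y∈ (∈supp⁻ Y e∈D) Sign.-
    with Z , Z∈ , Z⊆ ← eliminate Sign.+ X′∈ Y′∈
           (λ { refl → C≢D (trans (sym suppX′) (trans (supp-neg Y′) suppY′)) }) e∈X′ e∈Y′
    = supp Z , (Z , Z∈ , refl)
    , (λ e∈Z → let s , x = ∈support⁻ Z (∈supp⁻ Z e∈Z) in proj₂ (Z⊆ s x) refl)
    , (λ f∈Z → let s , x = ∈support⁻ Z (∈supp⁻ Z f∈Z) in
        x∈p∪q⁺ (Sum.map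
          (λ f∈X → subst (_ ∈ₛ_) suppX′ (∈supp⁺ X′ (∈support X′ s f∈X)))
          (λ f∈Y → subst (_ ∈ₛ_) suppY′ (∈supp⁺ Y′ (∈support Y′ s f∈Y)))
          (proj₁ (Z⊆ s x))))

  connected? : Binary.Decidable (Connected M)
  connected? e f = e Fin.≟ f ⊎-dec
    anySignedSubset? (λ X → circuit? X ×-dec (support? X e ×-dec support? X f))

  -- Circuits through `e`, `f` and through `f`, `g` meet in `f`, so some circuit contains both `e`
  -- and `g`.
  connected-trans : Binary.Transitive {A = Fin n} (Connected M)
  connected-trans (inj₁ refl) f~g = f~g
  connected-trans (inj₂ x)    (inj₁ refl) = inj₂ x
  connected-trans (inj₂ (X , X∈ , e∈X , f∈X)) (inj₂ (Y , Y∈ , f∈Y , g∈Y))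
    with _ , (Z , Z∈ , refl) , e∈Z , g∈Z ←
           MatroidCircuits.common-circuit supports-incomparable supports-elimination
             (X , X∈ , refl) (Y , Y∈ , refl) (∈supp⁺ X f∈X) (∈supp⁺ Y f∈Y) (∈supp⁺ X e∈X) (∈supp⁺ Y g∈Y)
    = inj₂ (Z , Z∈ , ∈supp⁻ Z e∈Z , ∈supp⁻ Z g∈Z)

  connected-isEquivalence : IsEquivalence (Connected M)
  connected-isEquivalence = record
    { refl  = inj₁ refl
    ; sym   = Sum.map sym (λ { (X , X∈ , e∈X , f∈X) → X , X∈ , f∈X , e∈X })
    ; trans = connected-trans
    }

  -- Unions of components and the reversals that preserve circuits

  open Representatives connected? connected-isEquivalence public

  Invariant : Pred (Subset n) 0ℓ
  Invariant C = ∀ {e f} → Connected M e f → lookup C e ≡ lookup C f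

  -- Any two elements of a circuit are connected, so `C` contains or misses all of it and reversal
  -- gives `X` or `- X`.
  reverse-circuit : ∀ {C X} → Invariant C → X ∈ Circuit M → reverse C X ∈ Circuit M
  reverse-circuit {C} {X} inv X∈ with any? (support? X)
  -- No element supplies the common value; the condition is vacuous, and `false` leaves `X` itself.
  ... | no X-empty = subst (Circuit M) (sym (reverse-constant false (λ {e} x → contradiction (e , x) X-empty))) X∈
  ... | yes (e , e∈X) = subst (Circuit M)
    (sym (reverse-constant (lookup C e) (λ f∈X → inv (inj₂ (X , X∈ , f∈X , e∈X))))) (if-± (lookup C e))
    where
    if-± : ∀ b → (if b then - X else X) ∈ Circuit M
    if-± true  = symmetric X∈
    if-± false = X∈

  reorient-⊕ : ∀ {C} A → Invariant C → Circuit (reorient (C ⊕ A)) ≐ Circuit (reorient A)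
  reorient-⊕ {C} A inv =
    (λ {X} X∈ → subst (Circuit M) (reverse-involutive C (reverse A X))
      (reverse-circuit inv (subst (Circuit M) (sym (reverse-reverse C A X)) X∈))) ,
    (λ {X} X∈ → subst (Circuit M) (reverse-reverse C A X) (reverse-circuit inv X∈))

  -- Reversal keeps the support, so by incomparability the result is `X` or `- X`. Comparing signs,
  -- `C` is constantly `false` or constantly `true` on the support.
  reverse-circuit⁻¹ : ∀ {C X e f} → X ∈ Circuit M → reverse C X ∈ Circuit M →
                      e ∈ support X → f ∈ support X → lookup C e ≡ lookup C f
  reverse-circuit⁻¹ {C} {X} {e} {f} X∈ CX∈ e∈X f∈X
    with incomparable CX∈ X∈ (λ {e} → proj₁ (support-reverse C X) {e})
  ... | inj₁ CX≡X = trans (same e∈X) (sym (same f∈X))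
    where
    same : ∀ {e} → e ∈ support X → lookup C e ≡ false
    same {e} e∈X with s , x ← ∈support⁻ X e∈X = flipBy-injective (lookup C e) _ s
      (just-injective (trans (sym (lookup-reverse C X x)) (trans (cong (λ X → lookup X e) CX≡X) x)))
  ... | inj₂ CX≡-X = trans (flipped e∈X) (sym (flipped f∈X))
    where
    flipped : ∀ {e} → e ∈ support X → lookup C e ≡ true
    flipped {e} e∈X with s , x ← ∈support⁻ X e∈X = flipBy-injective (lookup C e) _ s
      (just-injective (trans (sym (lookup-reverse C X x))
        (trans (cong (λ X → lookup X e) CX≡-X) (part-neg X x))))

  -- For a circuit `X` of `M`, `reverse A X` is a circuit of the first reorientation, hence of the
  -- second, so reversing `X` by `B ⊕ A` gives a circuit of `M`.
  reorient-⊆⇒invariant : ∀ A B → Circuit (reorient A) ⊆ Circuit (reorient B) → Invariant (B ⊕ A)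
  reorient-⊆⇒invariant A B A⊆B (inj₁ refl) = refl
  reorient-⊆⇒invariant A B A⊆B (inj₂ (X , X∈ , e∈X , f∈X)) = reverse-circuit⁻¹ X∈
    (subst (Circuit M) (reverse-reverse B A X) (A⊆B (subst (Circuit M) (sym (reverse-involutive A X)) X∈)))
    e∈X f∈X

  acyclic-resp : ∀ {N₁ N₂ : OrientedMatroid n} → Circuit N₂ ⊆ Circuit N₁ → Acyclic N₁ → Acyclic N₂
  acyclic-resp N₂⊆N₁ acyclic (X , X∈ , pos) = acyclic (X , N₂⊆N₁ X∈ , pos)

  -- Sets avoiding every representative, and acyclic reorientations

  Normal : Pred (Subset n) 0ℓ
  Normal A = ∀ e → lookup A (rep e) ≡ false

  normal? : Decidable Normal
  normal? A = all? (λ e → lookup A (rep e) Bool.≟ false)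

  AcyclicSets NormalAcyclicSets : Setoid _ _
  AcyclicSets       = Restrict (setoid (Subset n)) (Acyclic ∘ reorient)
  NormalAcyclicSets = Restrict (setoid (Subset n)) (λ A → Normal A × Acyclic (reorient A))

  -- The union of the components whose representative lies in `A`.
  offset : Subset n → Subset n
  offset A = tabulate (lookup A ∘ rep)

  offset-invariant : ∀ A → Invariant (offset A)
  offset-invariant A {e} {f} e~f = begin
    lookup (offset A) e ≡⟨ lookup∘tabulate _ e ⟩
    lookup A (rep e)    ≡⟨ cong (lookup A) (rep-cong e~f) ⟩
    lookup A (rep f)    ≡⟨ lookup∘tabulate _ f ⟨
    lookup (offset A) f ∎
    where open ≡-Reasoning

  normalise : Subset n → Subset n
  normalise A = offset A ⊕ A

  lookup-⊕ : ∀ (A B : Subset n) e → lookup (A ⊕ B) e ≡ lookup A e xor lookup B e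
  lookup-⊕ A B e = lookup-zipWith _xor_ e A B

  lookup-normalise : ∀ A e → lookup (normalise A) e ≡ lookup A (rep e) xor lookup A e
  lookup-normalise A e = trans (lookup-⊕ (offset A) A e) (cong (_xor lookup A e) (lookup∘tabulate _ e))

  normalise-normal : ∀ A → Normal (normalise A)
  normalise-normal A e = begin
    lookup (normalise A) (rep e)                     ≡⟨ lookup-normalise A (rep e) ⟩
    lookup A (rep (rep e)) xor lookup A (rep e)      ≡⟨ cong (λ f → lookup A f xor lookup A (rep e)) (rep-idem e) ⟩
    lookup A (rep e) xor lookup A (rep e)            ≡⟨ xor-same (lookup A (rep e)) ⟩
    false                                            ∎
    where open ≡-Reasoning

  -- `B ⊕ A` is constant on components and vanishes at the representatives, hence everywhere.
  normal-unique : ∀ {A B} → Normal A → Normal B → Circuit (reorient A) ⊆ Circuit (reorient B) → A ≡ B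
  normal-unique {A} {B} normalA normalB A⊆B = vec-ext (λ e → sym (xor≡false _ _ (begin
    lookup B e xor lookup A e             ≡⟨ lookup-⊕ B A e ⟨
    lookup (B ⊕ A) e                      ≡⟨ reorient-⊆⇒invariant A B A⊆B (rep-~ e) ⟩
    lookup (B ⊕ A) (rep e)                ≡⟨ lookup-⊕ B A (rep e) ⟩
    lookup B (rep e) xor lookup A (rep e) ≡⟨ cong₂ _xor_ (normalB e) (normalA e) ⟩
    false                                 ∎)))
    where
    open ≡-Reasoning
    xor≡false : ∀ a b → a xor b ≡ false → a ≡ b
    xor≡false true  true  _  = refl
    xor≡false false b     eq = sym eq

  reorient-normalise : ∀ A → Circuit (reorient (normalise A)) ≐ Circuit (reorient A)
  reorient-normalise A = reorient-⊕ A (offset-invariant A)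

  -- The reversing set carried by `N` is not determined by `N`; its normal form is, so the map
  -- respects equality of oriented matroids.
  acyclicReorientations↔normalAcyclicSets : Inverse (AcyclicReorientations M) NormalAcyclicSets
  acyclicReorientations↔normalAcyclicSets = mkInverse
    (λ { (N , (A , N≐) , acyclic) →
           normalise A , normalise-normal A ,
           acyclic-resp {N} {reorient (normalise A)} (proj₁ (normalise≐ N A N≐)) acyclic })
    (λ { (A , _ , acyclic) → reorient A , (A , reorient-image A) , acyclic })
    (λ { {N , (A , N≐) , _} {N′ , (A′ , N′≐) , _} N≐N′ →
           normal-unique (normalise-normal A) (normalise-normal A′)
             (λ x → proj₂ (normalise≐ N′ A′ N′≐) (proj₁ N≐N′ (proj₁ (normalise≐ N A N≐) x))) })
    (λ { refl → id , id })
    (λ { (A , normal , _) →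
           normal-unique (normalise-normal A) normal (proj₁ (reorient-normalise A)) })
    (λ { (N , (A , N≐) , _) → normalise≐ N A N≐ })
    where
    normalise≐ : ∀ (N : OrientedMatroid n) A → Circuit N ≐ Image (reverse A) (Circuit M) →
                 Circuit (reorient (normalise A)) ≐ Circuit N
    normalise≐ N A (⊆ , ⊇) =
      (λ x → ⊇ (proj₁ (reorient-image A) (proj₁ (reorient-normalise A) x))) ,
      (λ x → proj₂ (reorient-normalise A) (proj₂ (reorient-image A) (⊆ x)))

  -- Acyclic sets as pairs of a set of components and a normal set

  module _ {c} (reps : HasCardinality (Restrict (setoid (Fin n)) IsRep) c) where
    private
      index : Fin n → Fin c
      index e = Inverse.to reps (rep e , rep-idem e)

      element : Fin c → Fin n
      element = proj₁ ∘ Inverse.from reps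

      element-index : ∀ e → element (index e) ≡ rep e
      element-index e = Inverse.strictlyInverseʳ reps (rep e , rep-idem e)

      rep-element : ∀ i → rep (element i) ≡ element i
      rep-element i = proj₂ (Inverse.from reps i)

      index-element : ∀ i → index (element i) ≡ i
      index-element i = Inverse.inverseˡ reps (rep-element i)

      -- The union of the components whose numbers lie in `S`.
      spread : Subset c → Subset n
      spread S = tabulate (lookup S ∘ index)

      lookup-spread⊕ : ∀ S A e → lookup (spread S ⊕ A) e ≡ lookup S (index e) xor lookup A e
      lookup-spread⊕ S A e = trans (lookup-⊕ (spread S) A e) (cong (_xor lookup A e) (lookup∘tabulate _ e))

      spread-invariant : ∀ S → Invariant (spread S)
      spread-invariant S {e} {f} e~f = begin
        lookup (spread S) e ≡⟨ lookup∘tabulate _ e ⟩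
        lookup S (index e)  ≡⟨ cong (lookup S) (Inverse.to-cong reps (rep-cong e~f)) ⟩
        lookup S (index f)  ≡⟨ lookup∘tabulate _ f ⟨
        lookup (spread S) f ∎
        where open ≡-Reasoning

      reorient-spread : ∀ S A → Circuit (reorient (spread S ⊕ A)) ≐ Circuit (reorient A)
      reorient-spread S A = reorient-⊕ A (spread-invariant S)

      -- Records which representatives lie in `A`. Adding a normal set to `spread S` leaves this
      -- record equal to `S`.
      values : Subset n → Subset c
      values A = tabulate (lookup A ∘ element)

      values-spread : ∀ S {A} → Normal A → values (spread S ⊕ A) ≡ S
      values-spread S {A} normal = trans (tabulate-cong value) (tabulate∘lookup S)
        where
        open ≡-Reasoning
        value : ∀ i → lookup (spread S ⊕ A) (element i) ≡ lookup S i
        value i = begin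
          lookup (spread S ⊕ A) (element i)                       ≡⟨ lookup-spread⊕ S A (element i) ⟩
          lookup S (index (element i)) xor lookup A (element i)   ≡⟨ cong₂ (λ j e → lookup S j xor lookup A e) (index-element i) (sym (rep-element i)) ⟩
          lookup S i xor lookup A (rep (element i))               ≡⟨ cong (lookup S i xor_) (normal (element i)) ⟩
          lookup S i xor false                                    ≡⟨ xor-identityʳ (lookup S i) ⟩
          lookup S i                                              ∎

      spread-values : ∀ A → spread (values A) ⊕ normalise A ≡ A
      spread-values A = vec-ext (λ e → begin
        lookup (spread (values A) ⊕ normalise A) e
          ≡⟨ lookup-spread⊕ (values A) (normalise A) e ⟩
        lookup (values A) (index e) xor lookup (normalise A) e
          ≡⟨ cong₂ _xor_ (trans (lookup∘tabulate _ (index e)) (cong (lookup A) (element-index e))) (lookup-normalise A e) ⟩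
        lookup A (rep e) xor (lookup A (rep e) xor lookup A e)
          ≡⟨ xor-assoc (lookup A (rep e)) _ _ ⟨
        (lookup A (rep e) xor lookup A (rep e)) xor lookup A e
          ≡⟨ cong (_xor lookup A e) (xor-same (lookup A (rep e))) ⟩
        lookup A e ∎)
        where open ≡-Reasoning

    acyclicSets↔subsets×normalAcyclicSets : Inverse AcyclicSets (setoid (Subset c) ×ₛ NormalAcyclicSets)
    acyclicSets↔subsets×normalAcyclicSets = mkInverse
      (λ { (A , acyclic) → values A , normalise A , normalise-normal A ,
             acyclic-resp {reorient A} {reorient (normalise A)} (proj₁ (reorient-normalise A)) acyclic })
      (λ { (S , A , _ , acyclic) → spread S ⊕ A ,
             acyclic-resp {reorient A} {reorient (spread S ⊕ A)} (proj₁ (reorient-spread S A)) acyclic })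
      (λ { refl → refl , refl })
      (λ { (refl , refl) → refl })
      (λ { (S , A , normal , _) → values-spread S normal ,
             normal-unique (normalise-normal (spread S ⊕ A)) normal
               (λ x → proj₁ (reorient-spread S A) (proj₁ (reorient-normalise (spread S ⊕ A)) x)) })
      (λ { (A , _) → spread-values A })

-- Transitivity of colorings and acyclicity

acyclic? : (M : OrientedMatroid n) → Dec (Acyclic M)
acyclic? M = ¬? (anySignedSubset? (λ X → OrientedMatroid.circuit? M X ×-dec all? (¬? ∘ part? Sign.- X)))

neg-part : ∀ (X : SignedSubset n) {s e} → e ∈ part s (- X) → e ∈ part (opposite s) X
neg-part X {s} {e} e∈-X = subst (λ Y → e ∈ part (opposite s) Y) (neg-involutive X) (part-neg (- X) e∈-X)

-- Neither `X` nor `- X` is a positive circuit.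
acyclic⇒mixed : (M : OrientedMatroid n) → Acyclic M → ∀ {X} → X ∈ Circuit M → ∃ (X ⁺) × ∃ (X ⁻)
acyclic⇒mixed M acyclic {X} X∈ = positive , negative X∈
  where
  negative : ∀ {X} → X ∈ Circuit M → ∃ (X ⁻)
  negative {X} X∈ = decidable-stable (any? (part? Sign.- X))
    (λ none → acyclic (X , X∈ , λ e e∈X → none (e , e∈X)))

  positive : ∃ (X ⁺)
  positive with e , e∈-X ← negative (OrientedMatroid.symmetric M X∈) = e , neg-part X e∈-X

-- An element is in (reverse A X)⁻ exactly when it is in X⁺ ∩ A or in X⁻ ∖ A, so reverse A X is
-- positive or negative precisely when A separates X⁺ from X⁻.
module _ (M : OrientedMatroid n) where
  open Reorientation M

  transitive⇒acyclic : ∀ {ε} A → (∀ {e f} → ε e ≡ ε f → lookup A e ≡ lookup A f) →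
                       Transitive M ε → Acyclic (reorient A)
  transitive⇒acyclic A same transitive (X , AX∈ , positive)
    -- Two elements of one color have opposite signs in `reverse A X`. As `A` contains both or
    -- neither, their signs in `X` are opposite too, so one of them is negative.
    with _ , (e , e∈AX , refl) , (f , f∈AX , εf≡εe) ← transitive (reverse A X) AX∈
    = clash (lookup A e) (lookup A f) (same (sym εf≡εe)) (lookup-unreverse A X e∈AX) (lookup-unreverse A X f∈AX)
    where
    clash : ∀ b c {e f} → b ≡ c → e ∈ part (flipBy b Sign.+) X → ¬ (f ∈ part (flipBy c Sign.-) X)
    clash true  _ {e} refl e∈X _   = positive e e∈X
    clash false _ {f = f} refl _ f∈X = positive f f∈X

  acyclic⇒transitive : Acyclic M → ∀ {ε} A → (∀ {e f} → lookup A e ≡ lookup A f → ε e ≡ ε f) →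
                       Acyclic (reorient A) → Transitive M ε
  acyclic⇒transitive acyclic {ε} A same acyclicA X X∈
    with (e , e∈X) , (f , f∈X) ← acyclic⇒mixed M acyclic X∈
    with (g , g∈AX) , (h , h∈AX) ← acyclic⇒mixed (reorient A) acyclicA {reverse A X}
           (subst (Circuit M) (sym (reverse-involutive A X)) X∈)
    = choose _ _ _ _ refl refl refl refl e∈X f∈X (lookup-unreverse A X g∈AX) (lookup-unreverse A X h∈AX)
    where
    meet : ∀ {e f b} → lookup A e ≡ b → lookup A f ≡ b → e ∈ X ⁺ → f ∈ X ⁻ →
           Satisfiable (Image ε (X ⁺) ∩ Image ε (X ⁻))
    meet eq₁ eq₂ e∈X f∈X = _ , (_ , e∈X , refl) , (_ , f∈X , same (trans eq₂ (sym eq₁)))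

    -- If `A` separates `e` from `f`, a third element is used: `g` when `e` is in `A`, `h` when `f`
    -- is. Whether or not `A` contains it, it agrees with `e` or `f` under `A` and has the other
    -- sign in `X`. The values of `A` are arguments, so that matching on them evaluates `flipBy`.
    choose : ∀ {e f g h} b₁ b₂ b₃ b₄ →
             lookup A e ≡ b₁ → lookup A f ≡ b₂ → lookup A g ≡ b₃ → lookup A h ≡ b₄ →
             e ∈ X ⁺ → f ∈ X ⁻ → g ∈ part (flipBy b₃ Sign.+) X → h ∈ part (flipBy b₄ Sign.-) X →
             Satisfiable (Image ε (X ⁺) ∩ Image ε (X ⁻))
    choose true  true  _     _     p q r s e∈ f∈ g∈ h∈ = meet p q e∈ f∈
    choose false false _     _     p q r s e∈ f∈ g∈ h∈ = meet p q e∈ f∈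
    choose true  false true  _     p q r s e∈ f∈ g∈ h∈ = meet p r e∈ g∈
    choose true  false false _     p q r s e∈ f∈ g∈ h∈ = meet r q g∈ f∈
    choose false true  _     true  p q r s e∈ f∈ g∈ h∈ = meet s q h∈ f∈
    choose false true  _     false p q r s e∈ f∈ g∈ h∈ = meet p s e∈ h∈

  colorings↔acyclicSets : Acyclic M → Inverse (Transitive2Colorings M) AcyclicSets
  colorings↔acyclicSets acyclic = restrictInverse (Symmetry.inverse subset↔coloring)
    (λ {ε} → transitive⇒acyclic {ε} (tabulate (to ∘ ε)) (λ {e} {f} εe≡εf →
       trans (lookup∘tabulate _ e) (trans (cong to εe≡εf) (sym (lookup∘tabulate _ f)))))
    (λ {A} → acyclic⇒transitive acyclic A (cong from))
    where open Inverse 2↔Bool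

theorem1p16 : (n : ℕ) → .{{_ : NonZero n}} → (M : OrientedMatroid n) → Acyclic M →
    ∃ λ t → ∃ λ c → ∃ λ r →
    HasCardinality (Transitive2Colorings M) t ×
    HasCardinality (Components M) c ×
    HasCardinality (AcyclicReorientations M) r ×
    t ≡ 2 ^ c * r
theorem1p16 n M acyclic
  with c , reps ← restrictFin (Reorientation.isRep? M)
  with r , sets ← restrictFinite subset-cardinality
         (λ A → Reorientation.normal? M A ×-dec acyclic? (Reorientation.reorient M A)) (λ { refl → id })
  -- Here `c` counts representatives and `r` normal acyclic sets. The first count is obtained
  -- directly as this product, so the final equation is `refl`.
  = 2 ^ c * r , c , r
  , Composition.inverse (colorings↔acyclicSets M acyclic)
      (Composition.inverse (acyclicSets↔subsets×normalAcyclicSets reps)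
        (product-cardinality subset-cardinality sets))
  , Composition.inverse classes↔reps reps
  , Composition.inverse acyclicReorientations↔normalAcyclicSets sets
  , refl
  where open Reorientation M
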